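{- Let $(L,L^*)$ be either the pair $(\mathrm{sMC},\mathrm{sMC}^*)$ or the pair $(\mathrm{sCN},\mathrm{sCN}^*)$ of sequent calculi. For every finite set $\Gamma$ of formulas and every formula $\gamma$: (1) $L\vdash\Gamma\Rightarrow\gamma$ if and only if $L^*\vdash\Gamma\Rightarrow\gamma$; (2) $L-(\mathrm{cut})\vdash\Gamma\Rightarrow\gamma$ if and only if $L^*-(\mathrm{cut})\vdash\Gamma\Rightarrow\gamma$.
   Context: Formulas are built from countably many propositional variables $p,q,\dots$ using the binary connectives $\land,\lor,\to$ and the unary connective $\sim$. A sequent is an expression $\Gamma\Rightarrow\gamma$ with $\Gamma$ a finite (possibly empty) set of formulas and $\gamma$ a single formula; $\alpha,\Gamma$ means $\{\alpha\}\cup\Gamma$ and $\Gamma,\Delta$ means $\Gamma\cup\Delta$. $L\vdash S$ means that the sequent $S$ is provable in the calculus $L$, and $L-(\mathrm{cut})$ is $L$ without the rule (cut). The calculus $\mathrm{sC}$ has the following initial sequents and rules ($p$ any propositional variable; $\alpha,\beta,\gamma$ any formulas; $\Gamma,\Delta,\Sigma$ any finite sets of formulas). Initial sequents: (init1) $p,\Gamma\Rightarrow p$; (init2) $\sim p,\Gamma\Rightarrow\sim p$. (cut): from $\Gamma\Rightarrow\alpha$ and $\alpha,\Sigma\Rightarrow\gamma$ infer $\Gamma,\Sigma\Rightarrow\gamma$. ($\to$left): from $\Gamma\Rightarrow\alpha$ and $\beta,\Delta\Rightarrow\gamma$ infer $\alpha\to\beta,\Gamma,\Delta\Rightarrow\gamma$.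 ($\to$right): from $\alpha,\Gamma\Rightarrow\beta$ infer $\Gamma\Rightarrow\alpha\to\beta$. ($\land$left): from $\alpha,\beta,\Gamma\Rightarrow\gamma$ infer $\alpha\land\beta,\Gamma\Rightarrow\gamma$. ($\land$right): from $\Gamma\Rightarrow\alpha$ and $\Gamma\Rightarrow\beta$ infer $\Gamma\Rightarrow\alpha\land\beta$. ($\lor$left): from $\alpha,\Gamma\Rightarrow\gamma$ and $\beta,\Gamma\Rightarrow\gamma$ infer $\alpha\lor\beta,\Gamma\Rightarrow\gamma$. ($\lor$right1), ($\lor$right2): from $\Gamma\Rightarrow\alpha$ (respectively $\Gamma\Rightarrow\beta$) infer $\Gamma\Rightarrow\alpha\lor\beta$. ($\sim$left): from $\alpha,\Gamma\Rightarrow\gamma$ infer $\sim\sim\alpha,\Gamma\Rightarrow\gamma$. ($\sim$right): from $\Gamma\Rightarrow\alpha$ infer $\Gamma\Rightarrow\sim\sim\alpha$. ($\sim\to$left): from $\Gamma\Rightarrow\alpha$ and $\sim\beta,\Delta\Rightarrow\gamma$ infer $\sim(\alpha\to\beta),\Gamma,\Delta\Rightarrow\gamma$. ($\sim\to$right): from $\alpha,\Gamma\Rightarrow\sim\beta$ infer $\Gamma\Rightarrow\sim(\alpha\to\beta)$. ($\sim\land$left): from $\sim\alpha,\Gamma\Rightarrow\gamma$ and $\sim\beta,\Gamma\Rightarrow\gamma$ infer $\sim(\alpha\land\beta),\Gamma\Rightarrow\gamma$. ($\sim\land$right1), ($\sim\land$right2): from $\Gamma\Rightarrow\sim\alpha$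 (respectively $\Gamma\Rightarrow\sim\beta$) infer $\Gamma\Rightarrow\sim(\alpha\land\beta)$. ($\sim\lor$left): from $\sim\alpha,\sim\beta,\Gamma\Rightarrow\gamma$ infer $\sim(\alpha\lor\beta),\Gamma\Rightarrow\gamma$. ($\sim\lor$right): from $\Gamma\Rightarrow\sim\alpha$ and $\Gamma\Rightarrow\sim\beta$ infer $\Gamma\Rightarrow\sim(\alpha\lor\beta)$. Additional rules: (ex-middle): from $\sim\alpha,\Gamma\Rightarrow\gamma$ and $\alpha,\Gamma\Rightarrow\gamma$ infer $\Gamma\Rightarrow\gamma$. (Peirce): from $\alpha\to\beta,\Gamma\Rightarrow\alpha$ infer $\Gamma\Rightarrow\alpha$. (g-ex-middle): from $\alpha\to\beta,\Gamma\Rightarrow\gamma$ and $\alpha,\Gamma\Rightarrow\gamma$ infer $\Gamma\Rightarrow\gamma$. $\mathrm{sC3}=\mathrm{sC}+$(ex-middle); $\mathrm{sMC}=\mathrm{sC}+$(Peirce); $\mathrm{sCN}=\mathrm{sC3}+$(Peirce); $\mathrm{sMC}^*=\mathrm{sC}+$(g-ex-middle); $\mathrm{sCN}^*=\mathrm{sC3}+$(g-ex-middle). -}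

module Defs where

open import Data.List using (List; _∷_; _++_)
open import Data.List.Relation.Binary.BagAndSetEquality using (_∼[_]_; set)
open import Data.Nat using (ℕ)
open import Level using (0ℓ)
open import Relation.Unary using (Pred; _∈_; _∪_; _∖_; ｛_｝)

infix  9 ~_
infixr 8 _∧_
infixr 7 _∨_
infixr 6 _⟶_
infix  4 _⇒_
infix  3 _⊢_

data Formula : Set where
  var         : ℕ → Formula
  _∧_ _∨_ _⟶_ : Formula → Formula → Formula
  ~_          : Formula → Formula

-- Antecedents are finite sets, represented by lists: α , Γ is α ∷ Γ and
-- Γ , Δ is Γ ++ Δ.  Lists with the same members are identified by the
-- constructor `same-set` of _⊢_ below.
record Sequent : Set where
  constructor _⇒_
  field
    antecedent : List Formula
    succedent  : Formula

-- The rules that some of the calculi have and others lack.  The remaining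
-- rules belong to every calculus, so a calculus is determined by which of
-- these it contains.
data OptionalRule : Set where
  cut ex-middle Peirce g-ex-middle : OptionalRule

Calculus : Set₁
Calculus = Pred OptionalRule 0ℓ

sC sC3 sMC sCN sMC* sCN* : Calculus
sC   = ｛ cut ｝
sC3  = sC  ∪ ｛ ex-middle ｝
sMC  = sC  ∪ ｛ Peirce ｝
sCN  = sC3 ∪ ｛ Peirce ｝
sMC* = sC  ∪ ｛ g-ex-middle ｝
sCN* = sC3 ∪ ｛ g-ex-middle ｝

_-cut : Calculus → Calculus
L -cut = L ∖ ｛ cut ｝

private variable
  p       : ℕ
  α β γ   : Formula
  Γ Δ Σ   : List Formula

data _⊢_ (L : Calculus) : Sequent → Set where
  -- Not a rule of the calculi: Γ and Δ denote the same finite set, so the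
  -- two sequents are the same sequent.
  same-set : Γ ∼[ set ] Δ → L ⊢ Γ ⇒ γ → L ⊢ Δ ⇒ γ

  init1 : L ⊢ var p ∷ Γ ⇒ var p
  init2 : L ⊢ ~ var p ∷ Γ ⇒ ~ var p

  ⟶left  : L ⊢ Γ ⇒ α → L ⊢ β ∷ Δ ⇒ γ → L ⊢ (α ⟶ β) ∷ Γ ++ Δ ⇒ γ
  ⟶right : L ⊢ α ∷ Γ ⇒ β → L ⊢ Γ ⇒ α ⟶ β

  ∧left  : L ⊢ α ∷ β ∷ Γ ⇒ γ → L ⊢ (α ∧ β) ∷ Γ ⇒ γ
  ∧right : L ⊢ Γ ⇒ α → L ⊢ Γ ⇒ β → L ⊢ Γ ⇒ α ∧ β

  ∨left   : L ⊢ α ∷ Γ ⇒ γ → L ⊢ β ∷ Γ ⇒ γ → L ⊢ (α ∨ β) ∷ Γ ⇒ γ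
  ∨right1 : L ⊢ Γ ⇒ α → L ⊢ Γ ⇒ α ∨ β
  ∨right2 : L ⊢ Γ ⇒ β → L ⊢ Γ ⇒ α ∨ β

  ~left  : L ⊢ α ∷ Γ ⇒ γ → L ⊢ ~ ~ α ∷ Γ ⇒ γ
  ~right : L ⊢ Γ ⇒ α → L ⊢ Γ ⇒ ~ ~ α

  ~⟶left  : L ⊢ Γ ⇒ α → L ⊢ ~ β ∷ Δ ⇒ γ → L ⊢ ~ (α ⟶ β) ∷ Γ ++ Δ ⇒ γ
  ~⟶right : L ⊢ α ∷ Γ ⇒ ~ β → L ⊢ Γ ⇒ ~ (α ⟶ β)

  ~∧left   : L ⊢ ~ α ∷ Γ ⇒ γ → L ⊢ ~ β ∷ Γ ⇒ γ → L ⊢ ~ (α ∧ β) ∷ Γ ⇒ γ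
  ~∧right1 : L ⊢ Γ ⇒ ~ α → L ⊢ Γ ⇒ ~ (α ∧ β)
  ~∧right2 : L ⊢ Γ ⇒ ~ β → L ⊢ Γ ⇒ ~ (α ∧ β)

  ~∨left  : L ⊢ ~ α ∷ ~ β ∷ Γ ⇒ γ → L ⊢ ~ (α ∨ β) ∷ Γ ⇒ γ
  ~∨right : L ⊢ Γ ⇒ ~ α → L ⊢ Γ ⇒ ~ β → L ⊢ Γ ⇒ ~ (α ∨ β)

  cut         : cut ∈ L → L ⊢ Γ ⇒ α → L ⊢ α ∷ Σ ⇒ γ → L ⊢ Γ ++ Σ ⇒ γ
  ex-middle   : ex-middle ∈ L → L ⊢ ~ α ∷ Γ ⇒ γ → L ⊢ α ∷ Γ ⇒ γ → L ⊢ Γ ⇒ γ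
  Peirce      : Peirce ∈ L → L ⊢ (α ⟶ β) ∷ Γ ⇒ α → L ⊢ Γ ⇒ α
  g-ex-middle : g-ex-middle ∈ L → L ⊢ (α ⟶ β) ∷ Γ ⇒ γ → L ⊢ α ∷ Γ ⇒ γ → L ⊢ Γ ⇒ γ

{-# OPTIONS --safe #-}

-- Each of the calculi, with or without (cut), is sound and complete for the
-- two-valued semantics in which p and ~p are independent atoms (at least one of
-- them true if (ex-middle) is present) and a negated compound is read through
-- the ~-rules, e.g. ~(α → β) as α → ~β.  Hence the calculi of each pair prove
-- the same sequents.  Completeness without (cut) is a tableau search carried
-- out inside the calculus: "φ is false" is encoded by φ → δ in the antecedent,
-- where δ is the conjunction of all literals in sight.  (Peirce) introduces
-- such an implication, and since δ derives every formula in sight, (→left) can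
-- replace any current succedent by φ.
module Submission where

open import Defs
open import Data.Empty using (⊥-elim)
open import Data.List using (List; []; _∷_; _++_; foldr; map; concatMap)
open import Data.List.Membership.Propositional using (_∈_; _∉_; find; lose)
open import Data.List.Membership.Propositional.Properties using (∈-++⁻)
open import Data.List.Relation.Binary.Subset.Propositional using (_⊆_)
open import Data.List.Relation.Binary.Subset.Propositional.Properties
  using (⊆-trans; xs⊆xs++ys; xs⊆ys++xs)
open import Data.List.Relation.Unary.All as All using (All; []; _∷_)
open import Data.List.Relation.Unary.All.Properties
  using (++⁻; map⁺; map⁻; anti-mono; ¬Any⇒All¬)
open import Data.List.Relation.Unary.Any as Any using (Any; here; there)
open import Data.Nat using (ℕ)
open import Data.Nat.Properties using (_≟_)
open import Data.Product using (_×_; _,_; ∃-syntax; proj₁)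
open import Data.Sum as Sum using (_⊎_; inj₁; inj₂; [_,_]; swap)
open import Data.Sum.Properties using (≡-dec)
open import Function using (_∘_; id)
open import Function.Bundles using (_⇔_; mk⇔; Equivalence)
open import Level using (0ℓ)
open import Relation.Binary.Definitions using (DecidableEquality)
open import Relation.Binary.PropositionalEquality using (_≡_; refl)
open import Relation.Nullary using (¬_; Dec; yes; no; ¬?)
open import Relation.Nullary.Decidable using (_×-dec_; _⊎-dec_; _→-dec_)
open import Relation.Unary using (Pred; Decidable)

private variable
  L L*      : Calculus
  α β γ φ η : Formula
  Γ Δ Δ′    : List Formula

-- Unified notation

-- inj₁ p is the literal p, and inj₂ p is ~p.
Literal : Set
Literal = ℕ ⊎ ℕ

_≟ˡ_ : DecidableEquality Literal
_≟ˡ_ = ≡-dec _≟_ _≟_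

open import Data.List.Membership.DecPropositional _≟ˡ_ using (_∈?_)

⌜_⌝ : Literal → Formula
⌜_⌝ = [ var , (λ p → ~ var p) ]

-- ~~α is classified as a conjunction of α with itself.
data Conjunctive : Formula → Formula → Formula → Set where
  ∧-conj  : Conjunctive (α ∧ β) α β
  ~∨-conj : Conjunctive (~ (α ∨ β)) (~ α) (~ β)
  ~~-conj : Conjunctive (~ ~ α) α α

data Disjunctive : Formula → Formula → Formula → Set where
  ∨-disj  : Disjunctive (α ∨ β) α β
  ~∧-disj : Disjunctive (~ (α ∧ β)) (~ α) (~ β)

data Implicative : Formula → Formula → Formula → Set where
  ⟶-impl  : Implicative (α ⟶ β) α β
  ~⟶-impl : Implicative (~ (α ⟶ β)) α (~ β)

-- The components of ~(α ∧ β) are ~α and ~β, which are not subformulas. Storing the decomposition as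
-- data makes every later recursion structural.
data Tree : Formula → Set where
  lit  : ∀ l → Tree ⌜ l ⌝
  conj : Conjunctive φ α β → Tree α → Tree β → Tree φ
  disj : Disjunctive φ α β → Tree α → Tree β → Tree φ
  impl : Implicative φ α β → Tree α → Tree β → Tree φ

tree : ∀ φ → Tree φ
tree (var p)     = lit (inj₁ p)
tree (α ∧ β)     = conj ∧-conj (tree α) (tree β)
tree (α ∨ β)     = disj ∨-disj (tree α) (tree β)
tree (α ⟶ β)     = impl ⟶-impl (tree α) (tree β)
tree (~ var p)   = lit (inj₂ p)
tree (~ (α ∧ β)) = disj ~∧-disj (tree (~ α)) (tree (~ β))
tree (~ (α ∨ β)) = conj ~∨-conj (tree (~ α)) (tree (~ β))
tree (~ (α ⟶ β)) = impl ~⟶-impl (tree α) (tree (~ β))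
tree (~ ~ α)     = conj ~~-conj (tree α) (tree α)

literals : Tree φ → List Literal
literals (lit l)      = l ∷ []
literals (conj _ t u) = literals t ++ literals u
literals (disj _ t u) = literals t ++ literals u
literals (impl _ t u) = literals t ++ literals u

++-⊆ˡ : ∀ {A : Set} {xs ys zs : List A} → xs ++ ys ⊆ zs → xs ⊆ zs
++-⊆ˡ = ⊆-trans (xs⊆xs++ys _ _)

++-⊆ʳ : ∀ {A : Set} (xs : List A) {ys zs : List A} → xs ++ ys ⊆ zs → ys ⊆ zs
++-⊆ʳ xs = ⊆-trans (xs⊆ys++xs _ xs)

-- Semantics

Valuation : Set₁
Valuation = Pred Literal 0ℓ

⟦_⟧ : Tree φ → Valuation → Set
⟦ lit l ⟧      v = v l
⟦ conj _ t u ⟧ v = ⟦ t ⟧ v × ⟦ u ⟧ v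
⟦ disj _ t u ⟧ v = ⟦ t ⟧ v ⊎ ⟦ u ⟧ v
⟦ impl _ t u ⟧ v = ⟦ t ⟧ v → ⟦ u ⟧ v

⟦_⟧? : (t : Tree φ) {v : Valuation} → Decidable v → Dec (⟦ t ⟧ v)
⟦ lit l ⟧?      v? = v? l
⟦ conj _ t u ⟧? v? = ⟦ t ⟧? v? ×-dec ⟦ u ⟧? v?
⟦ disj _ t u ⟧? v? = ⟦ t ⟧? v? ⊎-dec ⟦ u ⟧? v?
⟦ impl _ t u ⟧? v? = ⟦ t ⟧? v? →-dec ⟦ u ⟧? v?

infix 4 _⊩_
_⊩_ : Valuation → Formula → Set
v ⊩ φ = ⟦ tree φ ⟧ v

record Model (L : Calculus) (v : Valuation) : Set where
  field
    decide : Decidable v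
    total  : L ex-middle → ∀ p → v (inj₁ p) ⊎ v (inj₂ p)

infix 3 _⊨_
_⊨_ : Calculus → Sequent → Set₁
L ⊨ Γ ⇒ γ = ∀ {v} → Model L v → All (v ⊩_) Γ → v ⊩ γ

⊩-excluded-middle : ∀ {v} → Decidable v → (∀ p → v (inj₁ p) ⊎ v (inj₂ p)) →
                    ∀ α → v ⊩ α ⊎ v ⊩ ~ α
⊩-excluded-middle {v} v? total = go
  where
  go : ∀ α → v ⊩ α ⊎ v ⊩ ~ α
  go (var p) = total p
  go (α ∧ β) with go α | go β
  ... | inj₁ a | inj₁ b = inj₁ (a , b)
  ... | inj₂ a | _      = inj₂ (inj₁ a)
  ... | inj₁ _ | inj₂ b = inj₂ (inj₂ b)
  go (α ∨ β) with go α | go β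
  ... | inj₁ a | _      = inj₁ (inj₁ a)
  ... | inj₂ _ | inj₁ b = inj₁ (inj₂ b)
  ... | inj₂ a | inj₂ b = inj₂ (a , b)
  -- Since ~(α → β) is read as α → ~β, whichever of β and ~β is true decides the case, whatever α
  -- is.
  go (α ⟶ β) with go β
  ... | inj₁ b = inj₁ λ _ → b
  ... | inj₂ b = inj₂ λ _ → b
  go (~ α) with go α
  ... | inj₁ a = inj₂ (a , a)
  ... | inj₂ a = inj₁ a

sound : L ⊢ Γ ⇒ γ → L ⊨ Γ ⇒ γ
sound {L} d {v} M = go d
  where
  open Model M

  go : L ⊢ Γ ⇒ γ → All (v ⊩_) Γ → v ⊩ γ
  go (same-set Γ∼Δ d) ρ = go d (anti-mono (Equivalence.to Γ∼Δ) ρ)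
  go init1 (a ∷ _) = a
  go init2 (a ∷ _) = a
  go (⟶left {Γ = Γ} d e) (f ∷ ρ) with ρ₁ , ρ₂ ← ++⁻ Γ ρ = go e (f (go d ρ₁) ∷ ρ₂)
  go (⟶right d) ρ a = go d (a ∷ ρ)
  go (∧left d) ((a , b) ∷ ρ) = go d (a ∷ b ∷ ρ)
  go (∧right d e) ρ = go d ρ , go e ρ
  go (∨left d e) (inj₁ a ∷ ρ) = go d (a ∷ ρ)
  go (∨left d e) (inj₂ b ∷ ρ) = go e (b ∷ ρ)
  go (∨right1 d) ρ = inj₁ (go d ρ)
  go (∨right2 d) ρ = inj₂ (go d ρ)
  go (~left d) ((a , _) ∷ ρ) = go d (a ∷ ρ)
  go (~right d) ρ = go d ρ , go d ρ
  go (~⟶left {Γ = Γ} d e) (f ∷ ρ) with ρ₁ , ρ₂ ← ++⁻ Γ ρ = go e (f (go d ρ₁) ∷ ρ₂)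
  go (~⟶right d) ρ a = go d (a ∷ ρ)
  go (~∧left d e) (inj₁ a ∷ ρ) = go d (a ∷ ρ)
  go (~∧left d e) (inj₂ b ∷ ρ) = go e (b ∷ ρ)
  go (~∧right1 d) ρ = inj₁ (go d ρ)
  go (~∧right2 d) ρ = inj₂ (go d ρ)
  go (~∨left d) ((a , b) ∷ ρ) = go d (a ∷ b ∷ ρ)
  go (~∨right d e) ρ = go d ρ , go e ρ
  go (cut {Γ = Γ} _ d e) ρ with ρ₁ , ρ₂ ← ++⁻ Γ ρ = go e (go d ρ₁ ∷ ρ₂)
  go (ex-middle {α = α} r d e) ρ with ⊩-excluded-middle decide (total r) α
  ... | inj₁ a = go e (a ∷ ρ)
  ... | inj₂ a = go d (a ∷ ρ)
  -- Decidability of the valuation allows a case split: if α is false, α → β holds vacuously and the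
  -- premise applies.
  go (Peirce {α = α} _ d) ρ with ⟦ tree α ⟧? decide
  ... | yes a = a
  ... | no ¬a = go d ((⊥-elim ∘ ¬a) ∷ ρ)
  go (g-ex-middle {α = α} _ d e) ρ with ⟦ tree α ⟧? decide
  ... | yes a = go e (a ∷ ρ)
  ... | no ¬a = go d ((⊥-elim ∘ ¬a) ∷ ρ)

-- Rules in unified notation, with the principal formula kept in the antecedent

same-members : Γ ⊆ Δ → Δ ⊆ Γ → L ⊢ Γ ⇒ γ → L ⊢ Δ ⇒ γ
same-members Γ⊆Δ Δ⊆Γ = same-set (mk⇔ Γ⊆Δ Δ⊆Γ)

contract : φ ∈ Δ → L ⊢ φ ∷ Δ ⇒ γ → L ⊢ Δ ⇒ γ
contract φ∈Δ = same-members (λ { (here refl) → φ∈Δ ; (there m) → m }) there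

contract++ : φ ∈ Δ → L ⊢ φ ∷ Δ ++ Δ ⇒ γ → L ⊢ Δ ⇒ γ
contract++ {Δ = Δ} φ∈Δ = same-members
  (λ { (here refl) → φ∈Δ ; (there m) → [ id , id ] (∈-++⁻ Δ m) })
  (there ∘ xs⊆xs++ys Δ Δ)

literal-axiom : ∀ l → ⌜ l ⌝ ∈ Δ → L ⊢ Δ ⇒ ⌜ l ⌝
literal-axiom (inj₁ p) l∈Δ = contract l∈Δ init1
literal-axiom (inj₂ p) l∈Δ = contract l∈Δ init2

conj-left : Conjunctive φ α β → φ ∈ Δ → L ⊢ α ∷ β ∷ Δ ⇒ γ → L ⊢ Δ ⇒ γ
conj-left ∧-conj  φ∈Δ d = contract φ∈Δ (∧left d)
conj-left ~∨-conj φ∈Δ d = contract φ∈Δ (~∨left d)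
-- The conjunctive reading supplies α twice; the duplicate is merged before `~left`.
conj-left ~~-conj φ∈Δ d = contract φ∈Δ (~left (contract (here refl) d))

conj-right : Conjunctive φ α β → L ⊢ Δ ⇒ α → L ⊢ Δ ⇒ β → L ⊢ Δ ⇒ φ
conj-right ∧-conj  d e = ∧right d e
conj-right ~∨-conj d e = ~∨right d e
conj-right ~~-conj d _ = ~right d

disj-left : Disjunctive φ α β → φ ∈ Δ → L ⊢ α ∷ Δ ⇒ γ → L ⊢ β ∷ Δ ⇒ γ → L ⊢ Δ ⇒ γ
disj-left ∨-disj  φ∈Δ d e = contract φ∈Δ (∨left d e)
disj-left ~∧-disj φ∈Δ d e = contract φ∈Δ (~∧left d e)

disj-right₁ : Disjunctive φ α β → L ⊢ Δ ⇒ α → L ⊢ Δ ⇒ φ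
disj-right₁ ∨-disj  = ∨right1
disj-right₁ ~∧-disj = ~∧right1

disj-right₂ : Disjunctive φ α β → L ⊢ Δ ⇒ β → L ⊢ Δ ⇒ φ
disj-right₂ ∨-disj  = ∨right2
disj-right₂ ~∧-disj = ~∧right2

impl-left : Implicative φ α β → φ ∈ Δ → L ⊢ Δ ⇒ α → L ⊢ β ∷ Δ ⇒ γ → L ⊢ Δ ⇒ γ
impl-left ⟶-impl  φ∈Δ d e = contract++ φ∈Δ (⟶left d e)
impl-left ~⟶-impl φ∈Δ d e = contract++ φ∈Δ (~⟶left d e)

impl-right : Implicative φ α β → L ⊢ α ∷ Δ ⇒ β → L ⊢ Δ ⇒ φ
impl-right ⟶-impl  = ⟶right
impl-right ~⟶-impl = ~⟶right

-- The initial sequents cover only literals; compounds follow by induction on the tree.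
identity : Tree φ → φ ∈ Δ → L ⊢ Δ ⇒ φ
identity (lit l) m = literal-axiom l m
identity (conj c t u) m = conj-left c m
  (conj-right c (identity t (here refl)) (identity u (there (here refl))))
identity (disj c t u) m = disj-left c m
  (disj-right₁ c (identity t (here refl))) (disj-right₂ c (identity u (here refl)))
identity (impl c t u) m = impl-right c
  (impl-left c (there m) (identity t (here refl)) (identity u (here refl)))

-- A formula that acts as falsum

⋀ : List Literal → Formula
-- The end value `var 0` is arbitrary: the conjunction only has to imply each literal of the list.
⋀ = foldr (λ l φ → ⌜ l ⌝ ∧ φ) (var 0)

⋀-derives-literal : ∀ {l V} → l ∈ V → ⋀ V ∈ Δ → L ⊢ Δ ⇒ ⌜ l ⌝
⋀-derives-literal {l = l} (here refl) m = conj-left ∧-conj m (literal-axiom l (here refl))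
⋀-derives-literal (there l∈V) m = conj-left ∧-conj m (⋀-derives-literal l∈V (there (here refl)))

-- Making all literals true makes every formula true: a disjunction holds by its left part, an
-- implication by its consequent.
⋀-derives : ∀ {V} (t : Tree φ) → literals t ⊆ V → ⋀ V ∈ Δ → L ⊢ Δ ⇒ φ
⋀-derives (lit l) t⊆V m = ⋀-derives-literal (t⊆V (here refl)) m
⋀-derives (conj c t u) tu⊆V m = conj-right c
  (⋀-derives t (++-⊆ˡ tu⊆V) m) (⋀-derives u (++-⊆ʳ (literals t) tu⊆V) m)
⋀-derives (disj c t u) tu⊆V m = disj-right₁ c (⋀-derives t (++-⊆ˡ tu⊆V) m)
⋀-derives (impl c t u) tu⊆V m =
  impl-right c (⋀-derives u (++-⊆ʳ (literals t) tu⊆V) (there m))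

-- Completeness

-- Stated as admissibility so that one completeness proof serves calculi with (Peirce) and calculi
-- with (g-ex-middle).
PeirceAdmissible : Calculus → Set
PeirceAdmissible L = ∀ {α β Γ} → L ⊢ (α ⟶ β) ∷ Γ ⇒ α → L ⊢ Γ ⇒ α

module Tableau (L : Calculus) (ex-middle? : Dec (L ex-middle))
               (peirce : PeirceAdmissible L) (V : List Literal) where

  δ : Formula
  δ = ⋀ V

  data Sign : Set where
    T F : Sign

  SignedTree : Set
  SignedTree = Sign × ∃[ φ ] Tree φ

  infix 4 _∋[_]_ _∋ˢ_ _⊨ˢ_

  _∋[_]_ : List Formula → Sign → Formula → Set
  Δ ∋[ T ] φ = φ ∈ Δ
  Δ ∋[ F ] φ = (φ ⟶ δ) ∈ Δ

  ∋-mono : ∀ s → Δ ⊆ Δ′ → Δ ∋[ s ] φ → Δ′ ∋[ s ] φ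
  ∋-mono T Δ⊆Δ′ = Δ⊆Δ′
  ∋-mono F Δ⊆Δ′ = Δ⊆Δ′

  _∋ˢ_ : List Formula → SignedTree → Set
  Δ ∋ˢ (s , φ , _) = Δ ∋[ s ] φ

  _⊨ˢ_ : Valuation → SignedTree → Set
  v ⊨ˢ (T , _ , t) = ⟦ t ⟧ v
  v ⊨ˢ (F , _ , t) = ¬ ⟦ t ⟧ v

  Derivable : Formula → Set
  Derivable η = ∀ {Δ} → δ ∈ Δ → L ⊢ Δ ⇒ η

  -- The succedent ranges only over formulas that `δ` derives, because `δ` replaces falsum only for
  -- those.
  Inconsistent : List Formula → Set
  Inconsistent Δ = ∀ {η} → Derivable η → L ⊢ Δ ⇒ η

  -- In a branch (A , B , C), the literals A are true, the literals B are
  -- false, and the signed trees C remain to be analysed.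
  Branch : Set
  Branch = List Literal × List Literal × List SignedTree

  Contains : List Formula → Branch → Set
  Contains Δ (A , B , C) =
    All (λ l → Δ ∋[ T ] ⌜ l ⌝) A × All (λ l → Δ ∋[ F ] ⌜ l ⌝) B × All (Δ ∋ˢ_) C

  Contains-mono : ∀ {b} → Δ ⊆ Δ′ → Contains Δ b → Contains Δ′ b
  Contains-mono Δ⊆Δ′ (as , bs , cs) =
    All.map Δ⊆Δ′ as , All.map Δ⊆Δ′ bs , All.map (λ {x} → ∋-mono (proj₁ x) Δ⊆Δ′) cs

  Closed Open : Branch → Set _
  Closed b = ∀ {Δ} → Contains Δ b → Inconsistent Δ
  Open (A , B , C) = ∃[ v ] Model L v × All v A × All (¬_ ∘ v) B × All (v ⊨ˢ_) C

  -- Quantifying over `A` and `B` lets literals found during the analysis be added to the branch.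
  Decided : List SignedTree → Set _
  Decided C = ∀ A B → Closed (A , B , C) ⊎ Open (A , B , C)

  -- (Peirce) with `δ` as its second formula: φ may be assumed false while it is being proved.
  prove : Derivable φ → Inconsistent ((φ ⟶ δ) ∷ Δ) → L ⊢ Δ ⇒ φ
  prove dφ inc = peirce (inc dφ)

  -- In (→left) the right premise gains `δ`, which derives the current succedent; only the left
  -- premise, with succedent φ, remains.
  refute : (φ ⟶ δ) ∈ Δ → L ⊢ Δ ⇒ φ → Inconsistent Δ
  refute m d dη = impl-left ⟶-impl m d (dη (here refl))

  -- A tableau rule has two halves: `close` turns closure of the result into a derivation, and
  -- `open₁₂` carries a countermodel back. `Branching` splits likewise.
  record Linear (c c₁ c₂ : SignedTree) : Set₁ where
    field
      close  : Δ ∋ˢ c → (∀ {Δ′} → Δ ⊆ Δ′ → Δ′ ∋ˢ c₁ → Δ′ ∋ˢ c₂ → Inconsistent Δ′) →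
               Inconsistent Δ
      open₁₂ : ∀ {v} → v ⊨ˢ c₁ → v ⊨ˢ c₂ → v ⊨ˢ c

  record Branching (c c₁ c₂ : SignedTree) : Set₁ where
    field
      close  : Δ ∋ˢ c → (∀ {Δ′} → Δ ⊆ Δ′ → Δ′ ∋ˢ c₁ → Inconsistent Δ′) →
               (∀ {Δ′} → Δ ⊆ Δ′ → Δ′ ∋ˢ c₂ → Inconsistent Δ′) → Inconsistent Δ
      open₁  : ∀ {v} → v ⊨ˢ c₁ → v ⊨ˢ c
      open₂  : ∀ {v} → v ⊨ˢ c₂ → v ⊨ˢ c

  linear : ∀ {c c₁ c₂ C} → Linear c c₁ c₂ → Decided (c₁ ∷ c₂ ∷ C) → Decided (c ∷ C)
  linear r k A B with k A B
  ... | inj₁ closed = inj₁ λ { (as , bs , m ∷ cs) → close m λ Δ⊆Δ′ m₁ m₂ →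
          let as′ , bs′ , cs′ = Contains-mono Δ⊆Δ′ (as , bs , cs)
          in closed (as′ , bs′ , m₁ ∷ m₂ ∷ cs′) }
    where open Linear r
  ... | inj₂ (v , M , as , bs , c₁ ∷ c₂ ∷ cs) = inj₂ (v , M , as , bs , open₁₂ c₁ c₂ ∷ cs)
    where open Linear r

  branching : ∀ {c c₁ c₂ C} → Branching c c₁ c₂ →
              Decided (c₁ ∷ C) → Decided (c₂ ∷ C) → Decided (c ∷ C)
  branching r k₁ k₂ A B with k₁ A B | k₂ A B
  ... | inj₂ (v , M , as , bs , c₁ ∷ cs) | _ = inj₂ (v , M , as , bs , open₁ c₁ ∷ cs)
    where open Branching r
  ... | inj₁ _ | inj₂ (v , M , as , bs , c₂ ∷ cs) = inj₂ (v , M , as , bs , open₂ c₂ ∷ cs)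
    where open Branching r
  ... | inj₁ closed₁ | inj₁ closed₂ = inj₁ λ { (as , bs , m ∷ cs) → close m
          (λ Δ⊆Δ′ m₁ → let as′ , bs′ , cs′ = Contains-mono Δ⊆Δ′ (as , bs , cs)
                       in closed₁ (as′ , bs′ , m₁ ∷ cs′))
          (λ Δ⊆Δ′ m₂ → let as′ , bs′ , cs′ = Contains-mono Δ⊆Δ′ (as , bs , cs)
                       in closed₂ (as′ , bs′ , m₂ ∷ cs′)) }
    where open Branching r

  module _ {t : Tree α} {u : Tree β} where

    T-conj : (c : Conjunctive φ α β) → Linear (T , φ , conj c t u) (T , α , t) (T , β , u)
    T-conj c = record
      { close = λ m k dη → conj-left c m (k (there ∘ there) (here refl) (there (here refl)) dη)
      ; open₁₂ = _,_ }

    T-disj : (c : Disjunctive φ α β) → Branching (T , φ , disj c t u) (T , α , t) (T , β , u)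
    T-disj c = record
      { close = λ m k₁ k₂ dη → disj-left c m (k₁ there (here refl) dη) (k₂ there (here refl) dη)
      ; open₁ = inj₁
      ; open₂ = inj₂ }

    T-impl : Derivable α → (c : Implicative φ α β) →
             Branching (T , φ , impl c t u) (F , α , t) (T , β , u)
    T-impl dα c = record
      { close = λ m k₁ k₂ dη →
          impl-left c m (prove dα (k₁ there (here refl))) (k₂ there (here refl) dη)
      ; open₁ = λ ¬a a → ⊥-elim (¬a a)
      ; open₂ = λ b _ → b }

    F-conj : Derivable α → Derivable β → (c : Conjunctive φ α β) →
             Branching (F , φ , conj c t u) (F , α , t) (F , β , u)
    F-conj dα dβ c = record
      { close = λ m k₁ k₂ → refute m
          (conj-right c (prove dα (k₁ there (here refl))) (prove dβ (k₂ there (here refl))))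
      ; open₁ = λ ¬a (a , _) → ¬a a
      ; open₂ = λ ¬b (_ , b) → ¬b b }

    F-disj : Derivable α → Derivable β → (c : Disjunctive φ α β) →
             Linear (F , φ , disj c t u) (F , α , t) (F , β , u)
    F-disj dα dβ c = record
      -- The right rule commits to one disjunct, so φ → `δ` is used twice: first to aim at α, then,
      -- with α → `δ` recorded, to aim at β.
      { close = λ m k → refute m (disj-right₁ c (prove dα (refute (there m)
          (disj-right₂ c (prove dβ (k (there ∘ there) (there (here refl)) (here refl)))))))
      ; open₁₂ = λ ¬a ¬b → [ ¬a , ¬b ] }

    F-impl : Derivable β → (c : Implicative φ α β) →
             Linear (F , φ , impl c t u) (T , α , t) (F , β , u)
    F-impl dβ c = record
      { close = λ m k → refute m
          (impl-right c (prove dβ (k (there ∘ there) (there (here refl)) (here refl))))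
      ; open₁₂ = λ a ¬b f → ¬b (f a) }

  -- Written in continuation style: the hypothesis on `C` handles whatever remains after `t`, so
  -- recursion on `t` alone suffices.
  expand : ∀ s (t : Tree φ) {C} → literals t ⊆ V → Decided C → Decided ((s , φ , t) ∷ C)
  expand T (lit l) _ k A B = Sum.map
    (λ closed → λ { (as , bs , m ∷ cs) → closed (m ∷ as , bs , cs) })
    (λ { (v , M , a ∷ as , bs , cs) → v , M , as , bs , a ∷ cs })
    (k (l ∷ A) B)
  expand F (lit l) _ k A B = Sum.map
    (λ closed → λ { (as , bs , m ∷ cs) → closed (as , m ∷ bs , cs) })
    (λ { (v , M , as , b ∷ bs , cs) → v , M , as , bs , b ∷ cs })
    (k A (l ∷ B))
  expand T (conj c t u) tu⊆V k =
    linear (T-conj c) (expand T t (++-⊆ˡ tu⊆V) (expand T u (++-⊆ʳ (literals t) tu⊆V) k))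
  expand F (conj c t u) tu⊆V k =
    branching (F-conj (⋀-derives t t⊆V) (⋀-derives u u⊆V) c)
              (expand F t t⊆V k) (expand F u u⊆V k)
    where
    t⊆V : literals t ⊆ V
    t⊆V = ++-⊆ˡ tu⊆V
    u⊆V : literals u ⊆ V
    u⊆V = ++-⊆ʳ (literals t) tu⊆V
  expand T (disj c t u) tu⊆V k =
    branching (T-disj c) (expand T t (++-⊆ˡ tu⊆V) k) (expand T u (++-⊆ʳ (literals t) tu⊆V) k)
  expand F (disj c t u) tu⊆V k =
    linear (F-disj (⋀-derives t t⊆V) (⋀-derives u u⊆V) c) (expand F t t⊆V (expand F u u⊆V k))
    where
    t⊆V : literals t ⊆ V
    t⊆V = ++-⊆ˡ tu⊆V
    u⊆V : literals u ⊆ V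
    u⊆V = ++-⊆ʳ (literals t) tu⊆V
  expand T (impl c t u) tu⊆V k =
    branching (T-impl (⋀-derives t t⊆V) c) (expand F t t⊆V k)
              (expand T u (++-⊆ʳ (literals t) tu⊆V) k)
    where
    t⊆V : literals t ⊆ V
    t⊆V = ++-⊆ˡ tu⊆V
  expand F (impl c t u) tu⊆V k =
    linear (F-impl (⋀-derives u u⊆V) c) (expand T t (++-⊆ˡ tu⊆V) (expand F u u⊆V k))
    where
    u⊆V : literals u ⊆ V
    u⊆V = ++-⊆ʳ (literals t) tu⊆V

  -- Without a clash, the literals outside B form a countermodel.
  decide-literals : Decided []
  decide-literals A B with Any.any? (_∈? B) A
  ... | yes clash = inj₁ λ (as , bs , _) →
    let l , l∈A , l∈B = find clash
    in refute (All.lookup bs l∈B) (literal-axiom l (All.lookup as l∈A))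
  ... | no consistent = Sum.map id
    (λ M → v , M , ¬Any⇒All¬ A consistent , All.tabulate (λ l∈B l∉B → l∉B l∈B) , [])
    (closed-or-model ex-middle?)
    where
    -- This is the largest valuation falsifying `B`, so totality can fail only if p and ~p both lie
    -- in `B`.
    v : Valuation
    v = _∉ B

    v? : Decidable v
    v? l = ¬? (l ∈? B)

    v-total : ¬ Any (λ l → swap l ∈ B) B → ∀ p → v (inj₁ p) ⊎ v (inj₂ p)
    v-total ¬clash p with inj₁ p ∈? B
    ... | yes p∈B = inj₂ λ ~p∈B → ¬clash (lose p∈B ~p∈B)
    ... | no  p∉B = inj₁ p∉B

    close : L ex-middle → All (λ l → Δ ∋[ F ] ⌜ l ⌝) B →
            ∃[ l ] l ∈ B × swap l ∈ B → Inconsistent Δ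
    -- Both p and ~p are marked false, so each case of (ex-middle) on p refutes one of the marks.
    close em bs (inj₁ p , p∈B , ~p∈B) dη = ex-middle em
      (refute (there (All.lookup bs ~p∈B)) init2 dη)
      (refute (there (All.lookup bs p∈B)) init1 dη)
    close em bs (inj₂ p , ~p∈B , p∈B) = close em bs (inj₁ p , p∈B , ~p∈B)

    closed-or-model : Dec (L ex-middle) → Closed (A , B , []) ⊎ Model L v
    closed-or-model (no ¬em) = inj₂ record { decide = v? ; total = ⊥-elim ∘ ¬em }
    closed-or-model (yes em) with Any.any? (λ l → swap l ∈? B) B
    ... | yes clash  = inj₁ λ (_ , bs , _) → close em bs (find clash)
    ... | no  ¬clash = inj₂ record { decide = v? ; total = λ _ → v-total ¬clash }

  expand-antecedent : ∀ Γ → concatMap (literals ∘ tree) Γ ⊆ V →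
                      Decided (map (λ φ → T , φ , tree φ) Γ)
  expand-antecedent []      _ = decide-literals
  expand-antecedent (φ ∷ Γ) Γ⊆V = expand T (tree φ) (++-⊆ˡ Γ⊆V)
    (expand-antecedent Γ (++-⊆ʳ (literals (tree φ)) Γ⊆V))

-- The search starts with Γ true and γ false. Closure gives a derivation once (Peirce) discharges γ
-- → `δ`; an open branch contradicts validity.
complete : Dec (L ex-middle) → PeirceAdmissible L → L ⊨ Γ ⇒ γ → L ⊢ Γ ⇒ γ
complete {L} {Γ} {γ} ex-middle? peirce valid =
  [ (λ closed → prove γ-derivable (closed ([] , [] , here refl ∷ map⁺ (All.tabulate there))))
  , (λ { (v , M , _ , _ , ¬γ ∷ Γ-true) → ⊥-elim (¬γ (valid M (map⁻ Γ-true))) })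
  ] (expand F (tree γ) γ⊆V (expand-antecedent Γ Γ⊆V) [] [])
  where
  V = literals (tree γ) ++ concatMap (literals ∘ tree) Γ
  open Tableau L ex-middle? peirce V

  γ⊆V : literals (tree γ) ⊆ V
  γ⊆V = xs⊆xs++ys _ _

  Γ⊆V : concatMap (literals ∘ tree) Γ ⊆ V
  Γ⊆V = xs⊆ys++xs _ (literals (tree γ))

  γ-derivable : Derivable γ
  γ-derivable = ⋀-derives (tree γ) γ⊆V

-- Comparison of the calculi

g-ex-middle⇒Peirce : L g-ex-middle → PeirceAdmissible L
-- With α itself as succedent, the second premise of (g-ex-middle) is an identity.
g-ex-middle⇒Peirce r {α} d = g-ex-middle r d (identity (tree α) (here refl))

-- Soundness of `L` followed by completeness of `L*`; the first hypothesis turns models of `L*` into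
-- models of `L`.
transfer : (L ex-middle → L* ex-middle) → Dec (L* ex-middle) → PeirceAdmissible L* →
           L ⊢ Γ ⇒ γ → L* ⊢ Γ ⇒ γ
transfer f em? peirce d = complete em? peirce λ M → sound d record
  { decide = Model.decide M
  ; total  = Model.total M ∘ f }

-- Nothing is assumed about (cut), so this yields both claims of the theorem.
equivalent : (¬ L ex-middle × ¬ L* ex-middle) ⊎ (L ex-middle × L* ex-middle) →
             L Peirce → L* g-ex-middle → (L ⊢ Γ ⇒ γ) ⇔ (L* ⊢ Γ ⇒ γ)
equivalent (inj₁ (¬em , ¬em*)) r r* = mk⇔
  (transfer (⊥-elim ∘ ¬em) (no ¬em*) (g-ex-middle⇒Peirce r*))
  (transfer (⊥-elim ∘ ¬em*) (no ¬em) (Peirce r))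
equivalent (inj₂ (em , em*)) r r* = mk⇔
  (transfer (λ _ → em*) (yes em*) (g-ex-middle⇒Peirce r*))
  (transfer (λ _ → em) (yes em) (Peirce r))

theorem2p12 : (L L* : Calculus) →
    (L , L*) ≡ (sMC , sMC*) ⊎ (L , L*) ≡ (sCN , sCN*) →
    (Γ : List Formula) (γ : Formula) →
    ((L ⊢ Γ ⇒ γ) ⇔ (L* ⊢ Γ ⇒ γ)) ×
    ((L -cut ⊢ Γ ⇒ γ) ⇔ (L* -cut ⊢ Γ ⇒ γ))
theorem2p12 L L* (inj₁ refl) Γ γ =
  equivalent (inj₁ (¬em , ¬em*)) (inj₂ refl) (inj₂ refl) ,
  -- Removing (cut) keeps the other rules; `λ ()` shows that they differ from `cut`.
  equivalent (inj₁ (¬em ∘ proj₁ , ¬em* ∘ proj₁)) (inj₂ refl , λ ()) (inj₂ refl , λ ())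
  where
  ¬em : ¬ sMC ex-middle
  ¬em = [ (λ ()) , (λ ()) ]
  ¬em* : ¬ sMC* ex-middle
  ¬em* = [ (λ ()) , (λ ()) ]
theorem2p12 L L* (inj₂ refl) Γ γ =
  equivalent (inj₂ (em , em)) (inj₂ refl) (inj₂ refl) ,
  equivalent (inj₂ ((em , λ ()) , (em , λ ()))) (inj₂ refl , λ ()) (inj₂ refl , λ ())
  where
  em : ∀ {A : Set} → sC3 ex-middle ⊎ A
  em = inj₁ (inj₂ refl)
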